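{- Let $k\ge0$. For all formulas $\varphi\in\mathcal{V}_{k+1}$ and $\psi\in\mathcal{Q}_{k+1}$ of the language of $\mathsf{HA}$, if $\mathsf{PA}\vdash\psi\to\varphi$, then $\mathsf{HA}+\mathrm{LEM}(\Sigma_k)\vdash\psi\to\varphi$.
   Context: $\mathsf{HA}$ is intuitionistic first-order arithmetic with function symbols for all primitive recursive functions and logical constants $\forall,\exists,\to,\land,\lor,\perp$ ($\neg\varphi:\equiv\varphi\to\perp$); $\mathsf{PA}$ is $\mathsf{HA}$ plus the law of excluded middle for all formulas. $\Sigma_0=\Pi_0$ is the class of quantifier-free formulas; $\Sigma_{k+1}$ consists of formulas $\exists x_1\cdots\exists x_n\varphi$ with $\varphi\in\Pi_k$, $\Pi_{k+1}$ of formulas $\forall x_1\cdots\forall x_n\varphi$ with $\varphi\in\Sigma_k$. $\mathrm{LEM}(\Sigma_k)$ is the scheme $\varphi\lor\neg\varphi$, $\varphi\in\Sigma_k$ (free variables allowed). Degree: an alternation path is a finite sequence of symbols $+,-$ in which they alternate; for a path $s$, $i(s)$ is its first symbol if $s$ is nonempty and a third symbol $\times$ if $s$ is empty, $s^\perp$ swaps $+$ and $-$, $l(s)$ is its length. The set $\mathrm{Alt}(\varphi)$: if $\varphi$ is quantifier-free, $\mathrm{Alt}(\varphi)=\{\langle\rangle\}$; otherwise $\mathrm{Alt}(\varphi_1\land\varphi_2)=\mathrm{Alt}(\varphi_1\lor\varphi_2)=\mathrm{Alt}(\varphi_1)\cup\mathrm{Alt}(\varphi_2)$, $\mathrm{Alt}(\varphi_1\to\varphi_2)=\{s^\perp:s\in\mathrm{Alt}(\varphi_1)\}\cup\mathrm{Alt}(\varphi_2)$,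 $\mathrm{Alt}(\forall x\varphi_1)=\{s\in\mathrm{Alt}(\varphi_1):i(s)=-\}\cup\{ -s:s\in\mathrm{Alt}(\varphi_1),i(s)\ne-\}$, $\mathrm{Alt}(\exists x\varphi_1)=\{s\in\mathrm{Alt}(\varphi_1):i(s)=+\}\cup\{+s:s\in\mathrm{Alt}(\varphi_1),i(s)\ne+\}$. $\deg(\varphi)=\max\{l(s):s\in\mathrm{Alt}(\varphi)\}$. $\mathrm{F}_k^+$ is the class of formulas of degree $\le k$. Classes: $\mathcal{R}_0=\mathcal{J}_0=\Sigma_0$. $\mathcal{R}_{k+1},\mathcal{J}_{k+1}$ are simultaneously inductively generated by: every $F\in\mathrm{F}_k^+$ is in both; if $R,R'\in\mathcal{R}_{k+1}$, $J,J'\in\mathcal{J}_{k+1}$, then $R\land R',R\lor R',\forall xR,J\to R\in\mathcal{R}_{k+1}$ and $J\land J',J\lor J',\exists xJ,R\to J\in\mathcal{J}_{k+1}$. $\mathcal{Q}_0=\Sigma_0$; $\mathcal{Q}_{k+1}$ is generated by: prime formulas are in it, and if $Q,Q'\in\mathcal{Q}_{k+1}$, $J\in\mathcal{J}_{k+1}$ then $Q\land Q',Q\lor Q',\forall xQ,\exists xQ,J\to Q\in\mathcal{Q}_{k+1}$. $\mathcal{V}_{k+1}$ is generated by: $\mathcal{J}_{k+1}\subseteq\mathcal{V}_{k+1}$, and if $V,V'\in\mathcal{V}_{k+1}$ then $V\land V',\forall xV\in\mathcal{V}_{k+1}$. -}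

module Defs where

open import Data.Nat using (ℕ; zero; suc; _≤_; _⊔_)
open import Data.Fin using (Fin; toℕ)
open import Data.Vec using (Vec; []; _∷_; tabulate; lookup)
import Data.Vec as Vec
open import Data.List using (List; []; _∷_; _++_; map; length; foldr)
open import Data.Bool using (Bool; true; false; if_then_else_; _∧_)
open import Data.Product using (Σ; _×_; _,_)
open import Data.Sum using (_⊎_)
open import Relation.Binary.PropositionalEquality using (_≡_)

data PR : ℕ → Set where
  pz    : PR 0
  ps    : PR 1
  pproj : {n : ℕ} → Fin n → PR n
  pcomp : {m n : ℕ} → PR m → Vec (PR n) m → PR n
  prec  : {n : ℕ} → PR n → PR (suc (suc n)) → PR (suc n)
          -- f(0,xs) = g(xs),  f(y+1,xs) = h(y, f(y,xs), xs)

data Term : Set where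
  var : ℕ → Term
  app : {n : ℕ} → PR n → Vec Term n → Term

0̇ : Term
0̇ = app pz []

Ṡ : Term → Term
Ṡ t = app ps (t ∷ [])

infix  7 _≐_
infixr 6 _∧̇_
infixr 5 _∨̇_
infixr 4 _⇒_

data Formula : Set where
  _≐_  : Term → Term → Formula
  ⊥̇    : Formula
  _∧̇_  : Formula → Formula → Formula
  _∨̇_  : Formula → Formula → Formula
  _⇒_  : Formula → Formula → Formula
  ∀̇    : Formula → Formula
  ∃̇    : Formula → Formula

¬̇ : Formula → Formula
¬̇ φ = φ ⇒ ⊥̇

Subst : Set
Subst = ℕ → Term

mutual
  substT : Subst → Term → Term
  substT σ (var x)    = σ x
  substT σ (app f ts) = app f (substTs σ ts)

  substTs : {n : ℕ} → Subst → Vec Term n → Vec Term n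
  substTs σ []       = []
  substTs σ (t ∷ ts) = substT σ t ∷ substTs σ ts

shiftT : Term → Term
shiftT = substT (λ x → var (suc x))

lift : Subst → Subst
lift σ zero    = var zero
lift σ (suc x) = shiftT (σ x)

subst : Subst → Formula → Formula
subst σ (s ≐ t)  = substT σ s ≐ substT σ t
subst σ ⊥̇        = ⊥̇
subst σ (φ ∧̇ ψ)  = subst σ φ ∧̇ subst σ ψ
subst σ (φ ∨̇ ψ)  = subst σ φ ∨̇ subst σ ψ
subst σ (φ ⇒ ψ)  = subst σ φ ⇒ subst σ ψ
subst σ (∀̇ φ)    = ∀̇ (subst (lift σ) φ)
subst σ (∃̇ φ)    = ∃̇ (subst (lift σ) φ)

shift : Formula → Formula
shift = subst (λ x → var (suc x))

sub0 : Term → Subst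
sub0 t zero    = t
sub0 t (suc x) = var x

_[_] : Formula → Term → Formula
φ [ t ] = subst (sub0 t) φ

vars : (n : ℕ) → Vec Term n
vars n = tabulate (λ i → var (toℕ i))

vars1 : (n : ℕ) → Vec Term n
vars1 n = tabulate (λ i → var (suc (toℕ i)))

succ0 : Subst
succ0 zero    = Ṡ (var zero)
succ0 (suc x) = var (suc x)

data HAax : Formula → Set where
  ax-refl  : HAax (var 0 ≐ var 0)
  ax-S≠0   : HAax (¬̇ (Ṡ (var 0) ≐ 0̇))
  ax-Sinj  : HAax (Ṡ (var 0) ≐ Ṡ (var 1) ⇒ var 0 ≐ var 1)
  ax-proj  : {n : ℕ} (i : Fin n) →
             HAax (app (pproj i) (vars n) ≐ lookup (vars n) i)
  ax-comp  : {m n : ℕ} (g : PR m) (hs : Vec (PR n) m) →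
             HAax (app (pcomp g hs) (vars n) ≐ app g (Vec.map (λ h → app h (vars n)) hs))
  ax-rec0  : {n : ℕ} (g : PR n) (h : PR (suc (suc n))) →
             HAax (app (prec g h) (0̇ ∷ vars1 n) ≐ app g (vars1 n))
  ax-recS  : {n : ℕ} (g : PR n) (h : PR (suc (suc n))) →
             HAax (app (prec g h) (Ṡ (var 0) ∷ vars1 n)
                   ≐ app h (var 0 ∷ app (prec g h) (var 0 ∷ vars1 n) ∷ vars1 n))
  ax-ind   : (φ : Formula) →
             HAax ((φ [ 0̇ ] ∧̇ ∀̇ (φ ⇒ subst succ0 φ)) ⇒ ∀̇ φ)

Theory : Set₁
Theory = Formula → Set

data _∈_ (φ : Formula) : List Formula → Set where
  here  : {Γ : List Formula} → φ ∈ (φ ∷ Γ)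
  there : {ψ : Formula} {Γ : List Formula} → φ ∈ Γ → φ ∈ (ψ ∷ Γ)

data Prf (T : Theory) : List Formula → Formula → Set where
  axiom : ∀ {Γ φ} → T φ → (σ : Subst) → Prf T Γ (subst σ φ)
  assum : ∀ {Γ φ} → φ ∈ Γ → Prf T Γ φ
  ∧I    : ∀ {Γ φ ψ} → Prf T Γ φ → Prf T Γ ψ → Prf T Γ (φ ∧̇ ψ)
  ∧E₁   : ∀ {Γ φ ψ} → Prf T Γ (φ ∧̇ ψ) → Prf T Γ φ
  ∧E₂   : ∀ {Γ φ ψ} → Prf T Γ (φ ∧̇ ψ) → Prf T Γ ψ
  ∨I₁   : ∀ {Γ φ ψ} → Prf T Γ φ → Prf T Γ (φ ∨̇ ψ)
  ∨I₂   : ∀ {Γ φ ψ} → Prf T Γ ψ → Prf T Γ (φ ∨̇ ψ)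
  ∨E    : ∀ {Γ φ ψ χ} → Prf T Γ (φ ∨̇ ψ) → Prf T (φ ∷ Γ) χ → Prf T (ψ ∷ Γ) χ → Prf T Γ χ
  ⇒I    : ∀ {Γ φ ψ} → Prf T (φ ∷ Γ) ψ → Prf T Γ (φ ⇒ ψ)
  ⇒E    : ∀ {Γ φ ψ} → Prf T Γ (φ ⇒ ψ) → Prf T Γ φ → Prf T Γ ψ
  ⊥E    : ∀ {Γ φ} → Prf T Γ ⊥̇ → Prf T Γ φ
  ∀I    : ∀ {Γ φ} → Prf T (map shift Γ) φ → Prf T Γ (∀̇ φ)
  ∀E    : ∀ {Γ φ} → Prf T Γ (∀̇ φ) → (t : Term) → Prf T Γ (φ [ t ])
  ∃I    : ∀ {Γ φ} (t : Term) → Prf T Γ (φ [ t ]) → Prf T Γ (∃̇ φ)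
  ∃E    : ∀ {Γ φ ψ} → Prf T Γ (∃̇ φ) → Prf T (φ ∷ map shift Γ) (shift ψ) → Prf T Γ ψ
  ≐E    : ∀ {Γ φ s t} → Prf T Γ (s ≐ t) → Prf T Γ (φ [ s ]) → Prf T Γ (φ [ t ])

_⊢_ : Theory → Formula → Set
T ⊢ φ = Prf T [] φ

data QF : Formula → Set where
  qf-eq : ∀ {s t} → QF (s ≐ t)
  qf-⊥  : QF ⊥̇
  qf-∧  : ∀ {φ ψ} → QF φ → QF ψ → QF (φ ∧̇ ψ)
  qf-∨  : ∀ {φ ψ} → QF φ → QF ψ → QF (φ ∨̇ ψ)
  qf-⇒  : ∀ {φ ψ} → QF φ → QF ψ → QF (φ ⇒ ψ)

data Prime : Formula → Set where
  pr-eq : ∀ {s t} → Prime (s ≐ t)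
  pr-⊥  : Prime ⊥̇

mutual
  data Σₕ : ℕ → Formula → Set where
    σ0 : ∀ {φ} → QF φ → Σₕ 0 φ
    σΠ : ∀ {k φ} → Πₕ k φ → Σₕ (suc k) φ
    σ∃ : ∀ {k φ} → Σₕ (suc k) φ → Σₕ (suc k) (∃̇ φ)

  data Πₕ : ℕ → Formula → Set where
    π0 : ∀ {φ} → QF φ → Πₕ 0 φ
    πΣ : ∀ {k φ} → Σₕ k φ → Πₕ (suc k) φ
    π∀ : ∀ {k φ} → Πₕ (suc k) φ → Πₕ (suc k) (∀̇ φ)

data LEMall : Formula → Set where
  lem : (φ : Formula) → LEMall (φ ∨̇ ¬̇ φ)

data LEMΣ (k : ℕ) : Formula → Set where
  lem : (φ : Formula) → Σₕ k φ → LEMΣ k (φ ∨̇ ¬̇ φ)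

HA : Theory
HA = HAax

PA : Theory
PA φ = HAax φ ⊎ LEMall φ

HA+LEMΣ : ℕ → Theory
HA+LEMΣ k φ = HAax φ ⊎ LEMΣ k φ

data Sym : Set where
  ⊕ ⊖ : Sym

Path : Set
Path = List Sym

isQF : Formula → Bool
isQF (s ≐ t) = true
isQF ⊥̇       = true
isQF (φ ∧̇ ψ) = isQF φ ∧ isQF ψ
isQF (φ ∨̇ ψ) = isQF φ ∧ isQF ψ
isQF (φ ⇒ ψ) = isQF φ ∧ isQF ψ
isQF (∀̇ φ)   = false
isQF (∃̇ φ)   = false

swap : Sym → Sym
swap ⊕ = ⊖
swap ⊖ = ⊕

_⊥ₚ : Path → Path
s ⊥ₚ = map swap s

addForall : Path → Path
addForall (⊖ ∷ s) = ⊖ ∷ s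
addForall s       = ⊖ ∷ s

addExists : Path → Path
addExists (⊕ ∷ s) = ⊕ ∷ s
addExists s       = ⊕ ∷ s

-- Alt(φ) as a finite list (duplicates irrelevant)
Alt : Formula → List Path
Alt φ = if isQF φ then [] ∷ [] else Alt' φ
  where
  Alt' : Formula → List Path
  Alt' (φ₁ ∧̇ φ₂) = Alt φ₁ ++ Alt φ₂
  Alt' (φ₁ ∨̇ φ₂) = Alt φ₁ ++ Alt φ₂
  Alt' (φ₁ ⇒ φ₂) = map _⊥ₚ (Alt φ₁) ++ Alt φ₂
  Alt' (∀̇ φ₁)    = map addForall (Alt φ₁)
  Alt' (∃̇ φ₁)    = map addExists (Alt φ₁)
  Alt' _         = [] ∷ []

deg : Formula → ℕ
deg φ = foldr _⊔_ 0 (map length (Alt φ))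

F⁺ : ℕ → Formula → Set
F⁺ k φ = deg φ ≤ k

mutual
  data 𝓡 : ℕ → Formula → Set where
    r0  : ∀ {φ} → QF φ → 𝓡 0 φ
    rF  : ∀ {k φ} → F⁺ k φ → 𝓡 (suc k) φ
    r∧  : ∀ {k φ ψ} → 𝓡 (suc k) φ → 𝓡 (suc k) ψ → 𝓡 (suc k) (φ ∧̇ ψ)
    r∨  : ∀ {k φ ψ} → 𝓡 (suc k) φ → 𝓡 (suc k) ψ → 𝓡 (suc k) (φ ∨̇ ψ)
    r∀  : ∀ {k φ} → 𝓡 (suc k) φ → 𝓡 (suc k) (∀̇ φ)
    r⇒  : ∀ {k φ ψ} → 𝓙 (suc k) φ → 𝓡 (suc k) ψ → 𝓡 (suc k) (φ ⇒ ψ)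

  data 𝓙 : ℕ → Formula → Set where
    j0  : ∀ {φ} → QF φ → 𝓙 0 φ
    jF  : ∀ {k φ} → F⁺ k φ → 𝓙 (suc k) φ
    j∧  : ∀ {k φ ψ} → 𝓙 (suc k) φ → 𝓙 (suc k) ψ → 𝓙 (suc k) (φ ∧̇ ψ)
    j∨  : ∀ {k φ ψ} → 𝓙 (suc k) φ → 𝓙 (suc k) ψ → 𝓙 (suc k) (φ ∨̇ ψ)
    j∃  : ∀ {k φ} → 𝓙 (suc k) φ → 𝓙 (suc k) (∃̇ φ)
    j⇒  : ∀ {k φ ψ} → 𝓡 (suc k) φ → 𝓙 (suc k) ψ → 𝓙 (suc k) (φ ⇒ ψ)

data 𝓠 : ℕ → Formula → Set where
  q0  : ∀ {φ} → QF φ → 𝓠 0 φ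
  qP  : ∀ {k φ} → Prime φ → 𝓠 (suc k) φ
  q∧  : ∀ {k φ ψ} → 𝓠 (suc k) φ → 𝓠 (suc k) ψ → 𝓠 (suc k) (φ ∧̇ ψ)
  q∨  : ∀ {k φ ψ} → 𝓠 (suc k) φ → 𝓠 (suc k) ψ → 𝓠 (suc k) (φ ∨̇ ψ)
  q∀  : ∀ {k φ} → 𝓠 (suc k) φ → 𝓠 (suc k) (∀̇ φ)
  q∃  : ∀ {k φ} → 𝓠 (suc k) φ → 𝓠 (suc k) (∃̇ φ)
  q⇒  : ∀ {k φ ψ} → 𝓙 (suc k) φ → 𝓠 (suc k) ψ → 𝓠 (suc k) (φ ⇒ ψ)

-- V_{k+1} (only defined for successor index)
data 𝓥 : ℕ → Formula → Set where
  vJ  : ∀ {k φ} → 𝓙 (suc k) φ → 𝓥 (suc k) φ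
  v∧  : ∀ {k φ ψ} → 𝓥 (suc k) φ → 𝓥 (suc k) ψ → 𝓥 (suc k) (φ ∧̇ ψ)
  v∀  : ∀ {k φ} → 𝓥 (suc k) φ → 𝓥 (suc k) (∀̇ φ)

{-# OPTIONS --safe #-}
-- Fix a formula C and let φ ↦ tr C φ be the Gödel–Gentzen translation in which C
-- plays the role of ⊥; it maps proofs of PA to proofs of HA.  In HA + LEM(Σ_k) one has
--   (¬ R → C) → tr C R           for R in 𝓡 (k+1),
--   (J → C) → tr C J → C         for J in 𝓙 (k+1),
--   Q → tr C Q                   for Q in 𝓠 (k+1).
-- Hence if PA proves Q → J, choosing C := J gives Q → tr J Q → tr J J → J in
-- HA + LEM(Σ_k).  The 𝓥-case reduces to this one by removing outer ∧ and ∀.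
-- The base case, formulas of degree ≤ k, rests on their decidability, which is
-- obtained by bringing the scope of each quantifier into prenex normal form.
module Submission where

open import Data.Bool using (true; false; if_then_else_; _∧_)
open import Data.List using (List; []; _∷_; _++_; map; length; foldr)
open import Data.List.Properties using (length-map; map-∘; map-cong)
open import Data.List.Relation.Unary.All as All using (All; []; _∷_)
open import Data.List.Relation.Unary.All.Properties using (++⁻; map⁻)
open import Data.Nat using (ℕ; zero; suc; _≤_; _⊔_; z≤n; s≤s; s≤s⁻¹)
open import Data.Nat.Properties using (≤-refl; ≤-trans; n≤1+n; m≤m⊔n; m≤n⊔m)
open import Data.Product using (∃; _×_; _,_; proj₂; map₁; map₂)
open import Data.Sum using (inj₁; inj₂)
open import Data.Vec using (Vec; []; _∷_)
open import Function using (_∘_)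
open import Relation.Binary.PropositionalEquality using (_≡_; refl; sym; trans; cong; cong₂) renaming (subst to transport)
open import Defs

-- Substitution calculus

mutual
  substT-cong : ∀ {σ τ} → (∀ x → σ x ≡ τ x) → ∀ t → substT σ t ≡ substT τ t
  substT-cong e (var x)    = e x
  substT-cong e (app f ts) = cong (app f) (substTs-cong e ts)

  substTs-cong : ∀ {n σ τ} → (∀ x → σ x ≡ τ x) → (ts : Vec Term n) → substTs σ ts ≡ substTs τ ts
  substTs-cong e []       = refl
  substTs-cong e (t ∷ ts) = cong₂ _∷_ (substT-cong e t) (substTs-cong e ts)

mutual
  substT-var : ∀ t → substT var t ≡ t
  substT-var (var x)    = refl
  substT-var (app f ts) = cong (app f) (substTs-var ts)

  substTs-var : ∀ {n} (ts : Vec Term n) → substTs var ts ≡ ts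
  substTs-var []       = refl
  substTs-var (t ∷ ts) = cong₂ _∷_ (substT-var t) (substTs-var ts)

mutual
  substT-∘ : ∀ τ σ t → substT τ (substT σ t) ≡ substT (substT τ ∘ σ) t
  substT-∘ τ σ (var x)    = refl
  substT-∘ τ σ (app f ts) = cong (app f) (substTs-∘ τ σ ts)

  substTs-∘ : ∀ {n} τ σ (ts : Vec Term n) → substTs τ (substTs σ ts) ≡ substTs (substT τ ∘ σ) ts
  substTs-∘ τ σ []       = refl
  substTs-∘ τ σ (t ∷ ts) = cong₂ _∷_ (substT-∘ τ σ t) (substTs-∘ τ σ ts)

lift-cong : ∀ {σ τ} → (∀ x → σ x ≡ τ x) → ∀ x → lift σ x ≡ lift τ x
lift-cong e zero    = refl
lift-cong e (suc x) = cong shiftT (e x)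

lift-var : ∀ x → lift var x ≡ var x
lift-var zero    = refl
lift-var (suc x) = refl

lift-∘ : ∀ τ σ x → substT (lift τ) (lift σ x) ≡ lift (substT τ ∘ σ) x
lift-∘ τ σ zero    = refl
lift-∘ τ σ (suc x) = trans (substT-∘ (lift τ) (var ∘ suc) (σ x)) (sym (substT-∘ (var ∘ suc) τ (σ x)))

subst-cong : ∀ {σ τ} → (∀ x → σ x ≡ τ x) → ∀ φ → subst σ φ ≡ subst τ φ
subst-cong e (s ≐ t) = cong₂ _≐_ (substT-cong e s) (substT-cong e t)
subst-cong e ⊥̇       = refl
subst-cong e (φ ∧̇ ψ) = cong₂ _∧̇_ (subst-cong e φ) (subst-cong e ψ)
subst-cong e (φ ∨̇ ψ) = cong₂ _∨̇_ (subst-cong e φ) (subst-cong e ψ)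
subst-cong e (φ ⇒ ψ) = cong₂ _⇒_ (subst-cong e φ) (subst-cong e ψ)
subst-cong e (∀̇ φ)   = cong ∀̇ (subst-cong (lift-cong e) φ)
subst-cong e (∃̇ φ)   = cong ∃̇ (subst-cong (lift-cong e) φ)

subst-var : ∀ φ → subst var φ ≡ φ
subst-var (s ≐ t) = cong₂ _≐_ (substT-var s) (substT-var t)
subst-var ⊥̇       = refl
subst-var (φ ∧̇ ψ) = cong₂ _∧̇_ (subst-var φ) (subst-var ψ)
subst-var (φ ∨̇ ψ) = cong₂ _∨̇_ (subst-var φ) (subst-var ψ)
subst-var (φ ⇒ ψ) = cong₂ _⇒_ (subst-var φ) (subst-var ψ)
subst-var (∀̇ φ)   = cong ∀̇ (trans (subst-cong lift-var φ) (subst-var φ))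
subst-var (∃̇ φ)   = cong ∃̇ (trans (subst-cong lift-var φ) (subst-var φ))

subst-∘ : ∀ τ σ φ → subst τ (subst σ φ) ≡ subst (substT τ ∘ σ) φ
subst-∘ τ σ (s ≐ t) = cong₂ _≐_ (substT-∘ τ σ s) (substT-∘ τ σ t)
subst-∘ τ σ ⊥̇       = refl
subst-∘ τ σ (φ ∧̇ ψ) = cong₂ _∧̇_ (subst-∘ τ σ φ) (subst-∘ τ σ ψ)
subst-∘ τ σ (φ ∨̇ ψ) = cong₂ _∨̇_ (subst-∘ τ σ φ) (subst-∘ τ σ ψ)
subst-∘ τ σ (φ ⇒ ψ) = cong₂ _⇒_ (subst-∘ τ σ φ) (subst-∘ τ σ ψ)
subst-∘ τ σ (∀̇ φ)   = cong ∀̇ (trans (subst-∘ (lift τ) (lift σ) φ) (subst-cong (lift-∘ τ σ) φ))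
subst-∘ τ σ (∃̇ φ)   = cong ∃̇ (trans (subst-∘ (lift τ) (lift σ) φ) (subst-cong (lift-∘ τ σ) φ))

subst-square : ∀ {σ τ σ′ τ′} → (∀ x → substT τ (σ x) ≡ substT τ′ (σ′ x)) →
               ∀ φ → subst τ (subst σ φ) ≡ subst τ′ (subst σ′ φ)
subst-square {σ} {τ} {σ′} {τ′} e φ =
  trans (subst-∘ τ σ φ) (trans (subst-cong e φ) (sym (subst-∘ τ′ σ′ φ)))

subst-shift : ∀ σ φ → subst (lift σ) (shift φ) ≡ shift (subst σ φ)
subst-shift σ = subst-square λ _ → refl

substT-shift-sub0 : ∀ t s → substT (sub0 t) (shiftT s) ≡ s
substT-shift-sub0 t s = trans (substT-∘ (sub0 t) (var ∘ suc) s) (substT-var s)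

shift-[] : ∀ φ t → shift φ [ t ] ≡ φ
shift-[] φ t = trans (subst-∘ (sub0 t) (var ∘ suc) φ) (subst-var φ)

subst-[] : ∀ σ φ t → subst σ (φ [ t ]) ≡ subst (lift σ) φ [ substT σ t ]
subst-[] σ φ t = subst-square
  (λ { zero → refl ; (suc x) → sym (substT-shift-sub0 (substT σ t) (σ x)) }) φ

-- Lets a bound variable serve as its own parameter: after a context shift, `∀E₀` and `∃I₀` open and
-- close a quantifier at `var 0`.
lift-shift-[] : ∀ φ → subst (lift (var ∘ suc)) φ [ var 0 ] ≡ φ
lift-shift-[] φ = trans (subst-∘ _ _ φ)
  (trans (subst-cong (λ { zero → refl ; (suc x) → refl }) φ) (subst-var φ))

subst-succ0 : ∀ σ φ → subst (lift σ) (subst succ0 φ) ≡ subst succ0 (subst (lift σ) φ)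
subst-succ0 σ = subst-square
  λ { zero → refl ; (suc x) → sym (substT-∘ succ0 (var ∘ suc) (σ x)) }

map-subst-shift : ∀ σ Γ → map (subst (lift σ)) (map shift Γ) ≡ map shift (map (subst σ) Γ)
map-subst-shift σ Γ = trans (sym (map-∘ Γ)) (trans (map-cong (subst-shift σ) Γ) (map-∘ Γ))

∈-map : ∀ (f : Formula → Formula) {φ Γ} → φ ∈ Γ → f φ ∈ map f Γ
∈-map f here      = here
∈-map f (there i) = there (∈-map f i)

∈-map⁻ : ∀ (f : Formula → Formula) {χ} Γ → χ ∈ map f Γ → ∃ λ φ → φ ∈ Γ × f φ ≡ χ
∈-map⁻ f (φ ∷ Γ) here = φ , here , refl
∈-map⁻ f (φ ∷ Γ) (there i) with ∈-map⁻ f Γ i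
... | ψ , j , e = ψ , there j , e

-- Derivations

_⊆_ : List Formula → List Formula → Set
Γ ⊆ Δ = ∀ {χ} → χ ∈ Γ → χ ∈ Δ

⊆-∷ : ∀ {Γ Δ φ} → Γ ⊆ Δ → (φ ∷ Γ) ⊆ (φ ∷ Δ)
⊆-∷ ρ here      = here
⊆-∷ ρ (there i) = there (ρ i)

⊆-map : ∀ f {Γ Δ} → Γ ⊆ Δ → map f Γ ⊆ map f Δ
⊆-map f {Γ} ρ i with ∈-map⁻ f Γ i
... | φ , j , refl = ∈-map f (ρ j)

weaken : ∀ {T Γ Δ φ} → Γ ⊆ Δ → Prf T Γ φ → Prf T Δ φ
weaken ρ (axiom a σ)  = axiom a σ
weaken ρ (assum i)    = assum (ρ i)
weaken ρ (∧I p q)     = ∧I (weaken ρ p) (weaken ρ q)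
weaken ρ (∧E₁ p)      = ∧E₁ (weaken ρ p)
weaken ρ (∧E₂ p)      = ∧E₂ (weaken ρ p)
weaken ρ (∨I₁ p)      = ∨I₁ (weaken ρ p)
weaken ρ (∨I₂ p)      = ∨I₂ (weaken ρ p)
weaken ρ (∨E p q r)   = ∨E (weaken ρ p) (weaken (⊆-∷ ρ) q) (weaken (⊆-∷ ρ) r)
weaken ρ (⇒I p)       = ⇒I (weaken (⊆-∷ ρ) p)
weaken ρ (⇒E p q)     = ⇒E (weaken ρ p) (weaken ρ q)
weaken ρ (⊥E p)       = ⊥E (weaken ρ p)
weaken ρ (∀I p)       = ∀I (weaken (⊆-map shift ρ) p)
weaken ρ (∀E p t)     = ∀E (weaken ρ p) t
weaken ρ (∃I t p)     = ∃I t (weaken ρ p)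
weaken ρ (∃E p q)     = ∃E (weaken ρ p) (weaken (⊆-∷ (⊆-map shift ρ)) q)
weaken ρ (≐E {φ = φ} p q) = ≐E {φ = φ} (weaken ρ p) (weaken ρ q)

cast : ∀ {T Γ φ ψ} → φ ≡ ψ → Prf T Γ φ → Prf T Γ ψ
cast {T} {Γ} = transport (Prf T Γ)

castΓ : ∀ {T Γ Δ φ} → Γ ≡ Δ → Prf T Γ φ → Prf T Δ φ
castΓ {T} {φ = φ} = transport (λ Γ → Prf T Γ φ)

-- The `axiom` rule carries its own substitution and so absorbs `σ`; at the eigenvariable rules `σ`
-- is lifted. It is applied through `↑`, which makes room for a fresh variable.
Prf-subst : ∀ {T Γ φ} σ → Prf T Γ φ → Prf T (map (subst σ) Γ) (subst σ φ)
Prf-subst σ (axiom {φ = φ} a τ) = cast (sym (subst-∘ σ τ φ)) (axiom a _)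
Prf-subst σ (assum i)    = assum (∈-map (subst σ) i)
Prf-subst σ (∧I p q)     = ∧I (Prf-subst σ p) (Prf-subst σ q)
Prf-subst σ (∧E₁ p)      = ∧E₁ (Prf-subst σ p)
Prf-subst σ (∧E₂ p)      = ∧E₂ (Prf-subst σ p)
Prf-subst σ (∨I₁ p)      = ∨I₁ (Prf-subst σ p)
Prf-subst σ (∨I₂ p)      = ∨I₂ (Prf-subst σ p)
Prf-subst σ (∨E p q r)   = ∨E (Prf-subst σ p) (Prf-subst σ q) (Prf-subst σ r)
Prf-subst σ (⇒I p)       = ⇒I (Prf-subst σ p)
Prf-subst σ (⇒E p q)     = ⇒E (Prf-subst σ p) (Prf-subst σ q)
Prf-subst σ (⊥E p)       = ⊥E (Prf-subst σ p)
Prf-subst {Γ = Γ} σ (∀I p) = ∀I (castΓ (map-subst-shift σ Γ) (Prf-subst (lift σ) p))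
Prf-subst σ (∀E {φ = φ} p t) = cast (sym (subst-[] σ φ t)) (∀E (Prf-subst σ p) (substT σ t))
Prf-subst σ (∃I {φ = φ} t p) = ∃I (substT σ t) (cast (subst-[] σ φ t) (Prf-subst σ p))
Prf-subst {Γ = Γ} σ (∃E {φ = φ} {ψ = ψ} p q) =
  ∃E (Prf-subst σ p)
     (castΓ (cong (subst (lift σ) φ ∷_) (map-subst-shift σ Γ))
       (cast (subst-shift σ ψ) (Prf-subst (lift σ) q)))
Prf-subst σ (≐E {φ = φ} {s} {t} p q) = cast (sym (subst-[] σ φ t))
  (≐E {φ = subst (lift σ) φ} (Prf-subst σ p) (cast (subst-[] σ φ s) (Prf-subst σ q)))

module _ {T : Theory} where

  private
    infix 3 _⊩_
    _⊩_ : List Formula → Formula → Set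
    _⊩_ = Prf T

  v0 : ∀ {Γ α} → α ∷ Γ ⊩ α
  v0 = assum here

  v1 : ∀ {Γ α β} → α ∷ β ∷ Γ ⊩ β
  v1 = assum (there here)

  v2 : ∀ {Γ α β γ} → α ∷ β ∷ γ ∷ Γ ⊩ γ
  v2 = assum (there (there here))

  wk : ∀ {Γ α φ} → Γ ⊩ φ → α ∷ Γ ⊩ φ
  wk = weaken there

  ↑ : ∀ {Γ φ} → Γ ⊩ φ → map shift Γ ⊩ shift φ
  ↑ = Prf-subst (var ∘ suc)

  ∀E₀ : ∀ {Γ φ} → Γ ⊩ shift (∀̇ φ) → Γ ⊩ φ
  ∀E₀ {φ = φ} p = cast (lift-shift-[] φ) (∀E p (var 0))

  ∃I₀ : ∀ {Γ φ} → Γ ⊩ φ → Γ ⊩ shift (∃̇ φ)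
  ∃I₀ {φ = φ} p = ∃I (var 0) (cast (sym (lift-shift-[] φ)) p)

  axiom₀ : ∀ {Γ φ} → T φ → Γ ⊩ φ
  axiom₀ {φ = φ} a = cast (subst-var φ) (axiom a var)

-- The translation

nn : Formula → Formula → Formula
nn C φ = (φ ⇒ C) ⇒ C

-- `C` may have free variables, so it is shifted at each binder. Equations, `∨̇` and `∃̇` get the
-- relative double negation `nn C`; the other connectives inherit stability.
tr : Formula → Formula → Formula
tr C (s ≐ t) = nn C (s ≐ t)
tr C ⊥̇       = C
tr C (φ ∧̇ ψ) = tr C φ ∧̇ tr C ψ
tr C (φ ∨̇ ψ) = nn C (tr C φ ∨̇ tr C ψ)
tr C (φ ⇒ ψ) = tr C φ ⇒ tr C ψ
tr C (∀̇ φ)   = ∀̇ (tr (shift C) φ)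
tr C (∃̇ φ)   = nn C (∃̇ (tr (shift C) φ))

tr-subst : ∀ σ C φ → subst σ (tr C φ) ≡ tr (subst σ C) (subst σ φ)
tr-subst-lift : ∀ σ C φ → subst (lift σ) (tr (shift C) φ) ≡ tr (shift (subst σ C)) (subst (lift σ) φ)

tr-subst σ C (s ≐ t) = refl
tr-subst σ C ⊥̇       = refl
tr-subst σ C (φ ∧̇ ψ) = cong₂ _∧̇_ (tr-subst σ C φ) (tr-subst σ C ψ)
tr-subst σ C (φ ∨̇ ψ) = cong (nn (subst σ C)) (cong₂ _∨̇_ (tr-subst σ C φ) (tr-subst σ C ψ))
tr-subst σ C (φ ⇒ ψ) = cong₂ _⇒_ (tr-subst σ C φ) (tr-subst σ C ψ)
tr-subst σ C (∀̇ φ)   = cong ∀̇ (tr-subst-lift σ C φ)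
tr-subst σ C (∃̇ φ)   = cong (nn (subst σ C) ∘ ∃̇) (tr-subst-lift σ C φ)

tr-subst-lift σ C φ = trans (tr-subst (lift σ) (shift C) φ)
  (cong (λ D → tr D (subst (lift σ) φ)) (subst-shift σ C))

tr-[] : ∀ C φ t → tr (shift C) φ [ t ] ≡ tr C (φ [ t ])
tr-[] C φ t = trans (tr-subst (sub0 t) (shift C) φ) (cong (λ D → tr D (φ [ t ])) (shift-[] C t))

map-tr-shift : ∀ C Γ → map (tr (shift C)) (map shift Γ) ≡ map shift (map (tr C) Γ)
map-tr-shift C Γ = trans (sym (map-∘ Γ)) (trans (map-cong (λ φ → sym (tr-subst _ C φ)) Γ) (map-∘ Γ))

module _ {T : Theory} where

  private
    infix 3 _⊩_
    _⊩_ : List Formula → Formula → Set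
    _⊩_ = Prf T

  nn-intro : ∀ {Γ C φ} → Γ ⊩ φ → Γ ⊩ nn C φ
  nn-intro p = ⇒I (⇒E v0 (wk p))

  nn-map : ∀ {Γ C φ ψ} → Γ ⊩ φ ⇒ ψ → Γ ⊩ nn C φ → Γ ⊩ nn C ψ
  nn-map f p = ⇒I (⇒E (wk p) (⇒I (⇒E v1 (⇒E (wk (wk f)) v0))))

  nn-join : ∀ {Γ C φ} → Γ ⊩ nn C (nn C φ) → Γ ⊩ nn C φ
  nn-join p = ⇒I (⇒E (wk p) (⇒I (⇒E v0 v1)))

  tr-stable : ∀ {Γ} C φ → Γ ⊩ nn C (tr C φ) → Γ ⊩ tr C φ
  tr-stable C (s ≐ t) p = nn-join p
  tr-stable C ⊥̇       p = ⇒E p (⇒I v0)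
  tr-stable C (φ ∧̇ ψ) p = ∧I (tr-stable C φ (nn-map (⇒I (∧E₁ v0)) p))
                             (tr-stable C ψ (nn-map (⇒I (∧E₂ v0)) p))
  tr-stable C (φ ∨̇ ψ) p = nn-join p
  tr-stable C (φ ⇒ ψ) p = ⇒I (tr-stable C ψ (nn-map (⇒I (⇒E v0 v1)) (wk p)))
  tr-stable C (∀̇ φ)   p = ∀I (tr-stable (shift C) φ (nn-map (⇒I (∀E₀ v0)) (↑ p)))
  tr-stable C (∃̇ φ)   p = nn-join p

  tr-absurd : ∀ {Γ} C φ → Γ ⊩ C → Γ ⊩ tr C φ
  tr-absurd C φ p = tr-stable C φ (⇒I (wk p))

  -- Stability of the goal strips `nn C` off a hypothesis; the elimination rules of `∨̇`, `∃̇` and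
  -- `≐` are translated this way.
  nn-bind : ∀ {Γ C φ} ψ → Γ ⊩ nn C φ → φ ∷ Γ ⊩ tr C ψ → Γ ⊩ tr C ψ
  nn-bind {C = C} ψ p q = tr-stable C ψ (nn-map (⇒I q) p)

  module _ (ha : ∀ {φ} → HAax φ → T φ) where

    tr-HAax : ∀ {Γ φ} C → HAax φ → (σ : Subst) → Γ ⊩ tr C (subst σ φ)
    tr-HAax C ax-refl       σ = nn-intro (axiom (ha ax-refl) σ)
    tr-HAax C ax-S≠0        σ = ⇒I (⇒E v0 (⇒I (⊥E (⇒E (axiom (ha ax-S≠0) σ) v0))))
    tr-HAax C ax-Sinj       σ = ⇒I (nn-map (axiom (ha ax-Sinj) σ) v0)
    tr-HAax C (ax-proj i)   σ = nn-intro (axiom (ha (ax-proj i)) σ)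
    tr-HAax C (ax-comp g h) σ = nn-intro (axiom (ha (ax-comp g h)) σ)
    tr-HAax C (ax-rec0 g h) σ = nn-intro (axiom (ha (ax-rec0 g h)) σ)
    tr-HAax C (ax-recS g h) σ = nn-intro (axiom (ha (ax-recS g h)) σ)
    -- The translated axiom is again an induction axiom, now for `φ′`; `base` and `step` match its
    -- two premises.
    tr-HAax {Γ} C (ax-ind φ) σ = cast
        (cong₂ (λ α β → (α ∧̇ ∀̇ (φ′ ⇒ β)) ⇒ ∀̇ φ′) base step)
        (axiom₀ (ha (ax-ind φ′)))
      where
      φ′ : Formula
      φ′ = tr (shift C) (subst (lift σ) φ)
      base : φ′ [ 0̇ ] ≡ tr C (subst σ (φ [ 0̇ ]))
      base = trans (tr-[] C (subst (lift σ) φ) 0̇) (cong (tr C) (sym (subst-[] σ φ 0̇)))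
      step : subst succ0 φ′ ≡ tr (shift C) (subst (lift σ) (subst succ0 φ))
      step = trans (tr-subst succ0 (shift C) (subst (lift σ) φ))
        (cong₂ tr (subst-∘ succ0 (var ∘ suc) C) (sym (subst-succ0 σ φ)))

    tr-sound : ∀ {Γ φ} C → Prf PA Γ φ → map (tr C) Γ ⊩ tr C φ
    tr-sound C (axiom (inj₁ a) σ)       = tr-HAax C a σ
    -- The goal is `nn C (A ∨̇ (A ⇒ C))` for the translated instance `A`: if the disjunction implies
    -- `C`, then so does `A`, which is the right disjunct.
    tr-sound C (axiom (inj₂ (lem φ)) σ) =
      ⇒I (⇒E v0 (∨I₂ (⇒I (⇒E v1 (∨I₁ v0)))))
    tr-sound C (assum i)    = assum (∈-map (tr C) i)
    tr-sound C (∧I p q)     = ∧I (tr-sound C p) (tr-sound C q)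
    tr-sound C (∧E₁ p)      = ∧E₁ (tr-sound C p)
    tr-sound C (∧E₂ p)      = ∧E₂ (tr-sound C p)
    tr-sound C (∨I₁ p)      = nn-intro (∨I₁ (tr-sound C p))
    tr-sound C (∨I₂ p)      = nn-intro (∨I₂ (tr-sound C p))
    tr-sound C (∨E {χ = χ} p q r) = nn-bind χ (tr-sound C p)
      (∨E v0 (weaken (⊆-∷ there) (tr-sound C q)) (weaken (⊆-∷ there) (tr-sound C r)))
    tr-sound C (⇒I p)       = ⇒I (tr-sound C p)
    tr-sound C (⇒E p q)     = ⇒E (tr-sound C p) (tr-sound C q)
    tr-sound C (⊥E {φ = φ} p) = tr-absurd C φ (tr-sound C p)
    tr-sound {Γ} C (∀I p)   = ∀I (castΓ (map-tr-shift C Γ) (tr-sound (shift C) p))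
    tr-sound C (∀E {φ = φ} p t) = cast (tr-[] C φ t) (∀E (tr-sound C p) t)
    tr-sound C (∃I {φ = φ} t p) = nn-intro (∃I t (cast (sym (tr-[] C φ t)) (tr-sound C p)))
    tr-sound {Γ} C (∃E {φ = φ} {ψ = ψ} p q) = nn-bind ψ (tr-sound C p)
      (∃E v0 (weaken (⊆-∷ there)
        (castΓ (cong (tr (shift C) φ ∷_) (map-tr-shift C Γ))
          (cast (sym (tr-subst _ C ψ)) (tr-sound (shift C) q)))))
    tr-sound C (≐E {φ = φ} {s} {t} p q) = nn-bind (φ [ t ]) (tr-sound C p)
      (cast (tr-[] C φ t) (≐E {φ = tr (shift C) φ} v0
        (cast (sym (tr-[] C φ s)) (wk (tr-sound C q)))))

-- Degree

-- Bounds are kept path by path rather than on the maximum `deg φ`, so that they split along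
-- connectives and can be reread under a further quantifier.
All-Alt : (Path → Set) → Formula → Set
All-Alt P φ = All P (Alt φ)

All-Alt-∧⁻ : ∀ {P} φ ψ → All-Alt P (φ ∧̇ ψ) → All-Alt P φ × All-Alt P ψ
All-Alt-∧⁻ φ ψ a with isQF φ | isQF ψ
... | true  | true  = a , a
... | true  | false = ++⁻ _ a
... | false | _     = ++⁻ _ a

All-Alt-∨⁻ : ∀ {P} φ ψ → All-Alt P (φ ∨̇ ψ) → All-Alt P φ × All-Alt P ψ
All-Alt-∨⁻ φ ψ a with isQF φ | isQF ψ
... | true  | true  = a , a
... | true  | false = ++⁻ _ a
... | false | _     = ++⁻ _ a

All-Alt-⇒⁻ : ∀ {P} φ ψ → All-Alt P (φ ⇒ ψ) → All-Alt (P ∘ _⊥ₚ) φ × All-Alt P ψ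
All-Alt-⇒⁻ φ ψ a with isQF φ | isQF ψ
-- The only path is the empty one, which is its own dual.
... | true  | true  = (All.head a ∷ []) , a
... | true  | false = let b , c = ++⁻ _ a in map⁻ b , c
... | false | _     = let b , c = ++⁻ _ a in map⁻ b , c

-- `Alt φ` is never empty; `Deg≤[]⇒1≤` needs one path to read off its bound.
All-Alt⇒∃ : ∀ {P} φ → All-Alt P φ → ∃ P
All-Alt⇒∃ (s ≐ t) a = _ , All.head a
All-Alt⇒∃ ⊥̇       a = _ , All.head a
All-Alt⇒∃ (φ ∧̇ ψ) a = All-Alt⇒∃ ψ (proj₂ (All-Alt-∧⁻ φ ψ a))
All-Alt⇒∃ (φ ∨̇ ψ) a = All-Alt⇒∃ ψ (proj₂ (All-Alt-∨⁻ φ ψ a))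
All-Alt⇒∃ (φ ⇒ ψ) a = All-Alt⇒∃ ψ (proj₂ (All-Alt-⇒⁻ φ ψ a))
All-Alt⇒∃ (∀̇ φ)   a = let s , p = All-Alt⇒∃ φ (map⁻ a) in _ , p
All-Alt⇒∃ (∃̇ φ)   a = let s , p = All-Alt⇒∃ φ (map⁻ a) in _ , p

add : Sym → Path → Path
add ⊕ = addExists
add ⊖ = addForall

add-idem : ∀ b s → add b (add b s) ≡ add b s
add-idem ⊕ []      = refl
add-idem ⊕ (⊕ ∷ s) = refl
add-idem ⊕ (⊖ ∷ s) = refl
add-idem ⊖ []      = refl
add-idem ⊖ (⊕ ∷ s) = refl
add-idem ⊖ (⊖ ∷ s) = refl

-- `add b s` begins with `b`, so a quantifier of the opposite sign always costs one more
-- alternation.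
length-add-swap : ∀ b s → length (add (swap b) (add b s)) ≡ suc (length (add b s))
length-add-swap ⊕ []      = refl
length-add-swap ⊕ (⊕ ∷ s) = refl
length-add-swap ⊕ (⊖ ∷ s) = refl
length-add-swap ⊖ []      = refl
length-add-swap ⊖ (⊕ ∷ s) = refl
length-add-swap ⊖ (⊖ ∷ s) = refl

length-⊥ₚ : ∀ s → length (s ⊥ₚ) ≡ length s
length-⊥ₚ = length-map swap

length-add-⊥ₚ : ∀ b s → length (add b (s ⊥ₚ)) ≡ length (add (swap b) s)
length-add-⊥ₚ ⊕ []      = refl
length-add-⊥ₚ ⊕ (⊕ ∷ s) = cong (suc ∘ suc) (length-⊥ₚ s)
length-add-⊥ₚ ⊕ (⊖ ∷ s) = cong suc (length-⊥ₚ s)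
length-add-⊥ₚ ⊖ []      = refl
length-add-⊥ₚ ⊖ (⊕ ∷ s) = cong suc (length-⊥ₚ s)
length-add-⊥ₚ ⊖ (⊖ ∷ s) = cong (suc ∘ suc) (length-⊥ₚ s)

1≤length-add : ∀ b s → 1 ≤ length (add b s)
1≤length-add ⊕ []      = s≤s z≤n
1≤length-add ⊕ (⊕ ∷ s) = s≤s z≤n
1≤length-add ⊕ (⊖ ∷ s) = s≤s z≤n
1≤length-add ⊖ []      = s≤s z≤n
1≤length-add ⊖ (⊕ ∷ s) = s≤s z≤n
1≤length-add ⊖ (⊖ ∷ s) = s≤s z≤n

Deg≤ : ℕ → Formula → Set
Deg≤ k = All-Alt (λ s → length s ≤ k)

-- The degree of a formula once a quantifier of sign b is put in front of it.
Deg≤[_] : Sym → ℕ → Formula → Set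
Deg≤[ b ] k = All-Alt (λ s → length (add b s) ≤ k)

All-length : ∀ {k} (l : List Path) → foldr _⊔_ 0 (map length l) ≤ k → All (λ s → length s ≤ k) l
All-length []      h = []
All-length (s ∷ l) h = ≤-trans (m≤m⊔n _ _) h ∷ All-length l (≤-trans (m≤n⊔m (length s) _) h)

F⁺⇒Deg≤ : ∀ {k} φ → F⁺ k φ → Deg≤ k φ
F⁺⇒Deg≤ φ = All-length (Alt φ)

Deg≤-⇒⁻ : ∀ {k} φ ψ → Deg≤ k (φ ⇒ ψ) → Deg≤ k φ × Deg≤ k ψ
Deg≤-⇒⁻ {k} φ ψ d = map₁ (All.map λ {s} → transport (_≤ k) (length-⊥ₚ s)) (All-Alt-⇒⁻ φ ψ d)

Deg≤[]-⇒⁻ : ∀ {b k} φ ψ → Deg≤[ b ] k (φ ⇒ ψ) → Deg≤[ swap b ] k φ × Deg≤[ b ] k ψ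
Deg≤[]-⇒⁻ {b} {k} φ ψ d =
  map₁ (All.map λ {s} → transport (_≤ k) (length-add-⊥ₚ b s)) (All-Alt-⇒⁻ φ ψ d)

Deg≤[]-same : ∀ {b k} φ → All (λ s → length (add b s) ≤ k) (map (add b) (Alt φ)) → Deg≤[ b ] k φ
Deg≤[]-same {b} {k} φ d =
  All.map (λ {s} → transport (λ u → length u ≤ k) (add-idem b s)) (map⁻ d)

-- A quantifier of sign `b` below one of the opposite sign uses up one level.
Deg≤[]-alternate : ∀ {b k} φ → All (λ s → length (add (swap b) s) ≤ suc k) (map (add b) (Alt φ)) →
                   Deg≤[ b ] k φ
Deg≤[]-alternate {b} {k} φ d =
  All.map (λ {s} → s≤s⁻¹ ∘ transport (_≤ suc k) (length-add-swap b s)) (map⁻ d)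

Deg≤[]⇒1≤ : ∀ {b k} φ → Deg≤[ b ] k φ → 1 ≤ k
Deg≤[]⇒1≤ {b} φ d = let s , p = All-Alt⇒∃ φ d in ≤-trans (1≤length-add b s) p

length≤add : ∀ b s → length s ≤ length (add b s)
length≤add ⊕ []      = z≤n
length≤add ⊕ (⊕ ∷ s) = ≤-refl
length≤add ⊕ (⊖ ∷ s) = n≤1+n _
length≤add ⊖ []      = z≤n
length≤add ⊖ (⊕ ∷ s) = n≤1+n _
length≤add ⊖ (⊖ ∷ s) = ≤-refl

Deg≤-∀⁻ : ∀ {k} φ → Deg≤ k (∀̇ φ) → Deg≤ k φ
Deg≤-∀⁻ φ d = All.map (λ {s} → ≤-trans (length≤add ⊖ s)) (map⁻ d)

Deg≤-∃⁻ : ∀ {k} φ → Deg≤ k (∃̇ φ) → Deg≤ k φ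
Deg≤-∃⁻ φ d = All.map (λ {s} → ≤-trans (length≤add ⊕ s)) (map⁻ d)

-- Invariance of the degree and of the formula classes under substitution

isQF-subst : ∀ σ φ → isQF (subst σ φ) ≡ isQF φ
isQF-subst σ (s ≐ t) = refl
isQF-subst σ ⊥̇       = refl
isQF-subst σ (φ ∧̇ ψ) = cong₂ _∧_ (isQF-subst σ φ) (isQF-subst σ ψ)
isQF-subst σ (φ ∨̇ ψ) = cong₂ _∧_ (isQF-subst σ φ) (isQF-subst σ ψ)
isQF-subst σ (φ ⇒ ψ) = cong₂ _∧_ (isQF-subst σ φ) (isQF-subst σ ψ)
isQF-subst σ (∀̇ φ)   = refl
isQF-subst σ (∃̇ φ)   = refl

Alt-subst : ∀ σ φ → Alt (subst σ φ) ≡ Alt φ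
Alt-subst σ (s ≐ t) = refl
Alt-subst σ ⊥̇       = refl
Alt-subst σ (φ ∧̇ ψ) = cong₂ (λ b l → if b then [] ∷ [] else l) (isQF-subst σ (φ ∧̇ ψ))
  (cong₂ _++_ (Alt-subst σ φ) (Alt-subst σ ψ))
Alt-subst σ (φ ∨̇ ψ) = cong₂ (λ b l → if b then [] ∷ [] else l) (isQF-subst σ (φ ∨̇ ψ))
  (cong₂ _++_ (Alt-subst σ φ) (Alt-subst σ ψ))
Alt-subst σ (φ ⇒ ψ) = cong₂ (λ b l → if b then [] ∷ [] else l) (isQF-subst σ (φ ⇒ ψ))
  (cong₂ _++_ (cong (map _⊥ₚ) (Alt-subst σ φ)) (Alt-subst σ ψ))
Alt-subst σ (∀̇ φ)   = cong (map addForall) (Alt-subst (lift σ) φ)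
Alt-subst σ (∃̇ φ)   = cong (map addExists) (Alt-subst (lift σ) φ)

F⁺-subst : ∀ {k} σ φ → F⁺ k φ → F⁺ k (subst σ φ)
F⁺-subst {k} σ φ = transport (λ l → foldr _⊔_ 0 (map length l) ≤ k) (sym (Alt-subst σ φ))

QF-subst : ∀ {φ} σ → QF φ → QF (subst σ φ)
QF-subst σ qf-eq      = qf-eq
QF-subst σ qf-⊥       = qf-⊥
QF-subst σ (qf-∧ p q) = qf-∧ (QF-subst σ p) (QF-subst σ q)
QF-subst σ (qf-∨ p q) = qf-∨ (QF-subst σ p) (QF-subst σ q)
QF-subst σ (qf-⇒ p q) = qf-⇒ (QF-subst σ p) (QF-subst σ q)

mutual
  𝓡-subst : ∀ {k φ} σ → 𝓡 k φ → 𝓡 k (subst σ φ)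
  𝓡-subst σ (r0 q)   = r0 (QF-subst σ q)
  𝓡-subst {φ = φ} σ (rF d) = rF (F⁺-subst σ φ d)
  𝓡-subst σ (r∧ p q) = r∧ (𝓡-subst σ p) (𝓡-subst σ q)
  𝓡-subst σ (r∨ p q) = r∨ (𝓡-subst σ p) (𝓡-subst σ q)
  𝓡-subst σ (r∀ p)   = r∀ (𝓡-subst (lift σ) p)
  𝓡-subst σ (r⇒ p q) = r⇒ (𝓙-subst σ p) (𝓡-subst σ q)

  𝓙-subst : ∀ {k φ} σ → 𝓙 k φ → 𝓙 k (subst σ φ)
  𝓙-subst σ (j0 q)   = j0 (QF-subst σ q)
  𝓙-subst {φ = φ} σ (jF d) = jF (F⁺-subst σ φ d)
  𝓙-subst σ (j∧ p q) = j∧ (𝓙-subst σ p) (𝓙-subst σ q)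
  𝓙-subst σ (j∨ p q) = j∨ (𝓙-subst σ p) (𝓙-subst σ q)
  𝓙-subst σ (j∃ p)   = j∃ (𝓙-subst (lift σ) p)
  𝓙-subst σ (j⇒ p q) = j⇒ (𝓡-subst σ p) (𝓙-subst σ q)

𝓠-subst : ∀ {k φ} σ → 𝓠 k φ → 𝓠 k (subst σ φ)
𝓠-subst σ (q0 q)      = q0 (QF-subst σ q)
𝓠-subst σ (qP pr-eq)  = qP pr-eq
𝓠-subst σ (qP pr-⊥)   = qP pr-⊥
𝓠-subst σ (q∧ p q)    = q∧ (𝓠-subst σ p) (𝓠-subst σ q)
𝓠-subst σ (q∨ p q)    = q∨ (𝓠-subst σ p) (𝓠-subst σ q)
𝓠-subst σ (q∀ p)      = q∀ (𝓠-subst (lift σ) p)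
𝓠-subst σ (q∃ p)      = q∃ (𝓠-subst (lift σ) p)
𝓠-subst σ (q⇒ p q)    = q⇒ (𝓙-subst σ p) (𝓠-subst σ q)

-- Prenex formulas: H ⊕ k is Σₕ k and H ⊖ k is Πₕ k.

data H : Sym → ℕ → Formula → Set where
  h0 : ∀ {b φ} → QF φ → H b 0 φ
  hs : ∀ {b k φ} → H (swap b) k φ → H b (suc k) φ
  h∃ : ∀ {k φ} → H ⊕ (suc k) φ → H ⊕ (suc k) (∃̇ φ)
  h∀ : ∀ {k φ} → H ⊖ (suc k) φ → H ⊖ (suc k) (∀̇ φ)

mutual
  H⇒Σₕ : ∀ {k φ} → H ⊕ k φ → Σₕ k φ
  H⇒Σₕ (h0 q) = σ0 q
  H⇒Σₕ (hs h) = σΠ (H⇒Πₕ h)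
  H⇒Σₕ (h∃ h) = σ∃ (H⇒Σₕ h)

  H⇒Πₕ : ∀ {k φ} → H ⊖ k φ → Πₕ k φ
  H⇒Πₕ (h0 q) = π0 q
  H⇒Πₕ (hs h) = πΣ (H⇒Σₕ h)
  H⇒Πₕ (h∀ h) = π∀ (H⇒Πₕ h)

QF⇒H : ∀ {φ} b k → QF φ → H b k φ
QF⇒H b zero    q = h0 q
QF⇒H b (suc k) q = hs (QF⇒H (swap b) k q)

H-mono : ∀ {b k m φ} → k ≤ m → H b k φ → H b m φ
H-mono {b} z≤n (h0 q) = QF⇒H b _ q
H-mono (s≤s l) (hs h) = hs (H-mono l h)
H-mono (s≤s l) (h∃ h) = h∃ (H-mono (s≤s l) h)
H-mono (s≤s l) (h∀ h) = h∀ (H-mono (s≤s l) h)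

H-subst : ∀ {b k φ} σ → H b k φ → H b k (subst σ φ)
H-subst σ (h0 q) = h0 (QF-subst σ q)
H-subst σ (hs h) = hs (H-subst σ h)
H-subst σ (h∃ h) = h∃ (H-subst (lift σ) h)
H-subst σ (h∀ h) = h∀ (H-subst (lift σ) h)

-- Decidability of prenex formulas in HA + LEM(Σ_K)

module Conservation (K : ℕ) where

  private
    T : Theory
    T = HA+LEMΣ K

    infix 3 _⊩_
    _⊩_ : List Formula → Formula → Set
    _⊩_ = Prf T

  LEM-H : ∀ {k φ Γ} → k ≤ K → H ⊕ k φ → Γ ⊩ φ ∨̇ ¬̇ φ
  LEM-H l h = axiom₀ (inj₂ (lem _ (H⇒Σₕ (H-mono l h))))

  -- A positive form of decidability: `χ` is equivalent to `¬̇ φ` but can be chosen prenex. Both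
  -- fields hold in every context, hence also under binders.
  record Complement (φ χ : Formula) : Set where
    constructor compl
    field
      total    : ∀ {Γ} → Γ ⊩ φ ∨̇ χ
      disjoint : ∀ {Γ} → Γ ⊩ φ → Γ ⊩ χ → Γ ⊩ ⊥̇
  open Complement

  Complement-sym : ∀ {φ χ} → Complement φ χ → Complement χ φ
  Complement-sym c .total        = ∨E (total c) (∨I₂ v0) (∨I₁ v0)
  Complement-sym c .disjoint p q = disjoint c q p

  -- If `∃̇ φ` is refuted, the alternative `φ` of `total c` is absurd at each point, which leaves
  -- `χ`.
  Complement-∃∀ : ∀ {φ χ} → (∀ {Γ} → Γ ⊩ ∃̇ φ ∨̇ ¬̇ (∃̇ φ)) → Complement φ χ → Complement (∃̇ φ) (∀̇ χ)
  Complement-∃∀ d c .total = ∨E d (∨I₁ v0)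
    (∨I₂ (∀I (∨E (total c) (⊥E (⇒E v1 (∃I₀ v0))) v0)))
  Complement-∃∀ d c .disjoint p q = ∃E p (disjoint c v0 (∀E₀ (wk (↑ q))))

  complement : ∀ {b k φ} → k ≤ K → H b k φ → ∃ λ χ → H (swap b) k χ × Complement φ χ
  complement {φ = φ} l (h0 q) = ¬̇ φ , h0 (qf-⇒ q qf-⊥) , compl (LEM-H l (h0 q)) (λ p r → ⇒E r p)
  complement {⊕} l (hs h) = map₂ (λ (h′ , c) → hs h′ , c) (complement (≤-trans (n≤1+n _) l) h)
  complement {⊖} l (hs h) = map₂ (λ (h′ , c) → hs h′ , c) (complement (≤-trans (n≤1+n _) l) h)
  complement l (h∃ h) =
    let χ , h′ , c = complement l h
    in  ∀̇ χ , h∀ h′ , Complement-∃∀ (LEM-H l (h∃ h)) c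
  -- `LEM-H` covers the sign `⊕` only, so a universal formula is decided through its existential
  -- complement `∃̇ χ`.
  complement l (h∀ h) =
    let χ , h′ , c = complement l h
    in  ∃̇ χ , h∃ h′ , Complement-sym (Complement-∃∀ (LEM-H l (h∃ h′)) (Complement-sym c))

  -- Prenex normal forms

  record Prenex (b : Sym) (k : ℕ) (φ : Formula) : Set where
    constructor prenex
    field
      {nf} : Formula
      hier : H b k nf
      to   : ∀ {Γ} → Γ ⊩ φ → Γ ⊩ nf
      from : ∀ {Γ} → Γ ⊩ nf → Γ ⊩ φ

  Prenex-≈ : ∀ {b k φ ψ} → (∀ {Γ} → Γ ⊩ φ → Γ ⊩ ψ) → (∀ {Γ} → Γ ⊩ ψ → Γ ⊩ φ) →
             Prenex b k φ → Prenex b k ψ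
  Prenex-≈ f g (prenex h t u) = prenex h (t ∘ g) (f ∘ u)

  Prenex-QF : ∀ {b k φ} → QF φ → Prenex b k φ
  Prenex-QF q = prenex (QF⇒H _ _ q) (λ p → p) (λ p → p)

  Prenex-hs : ∀ {b k φ} → Prenex (swap b) k φ → Prenex b (suc k) φ
  Prenex-hs (prenex h t u) = prenex (hs h) t u

  Prenex-∃ : ∀ {k φ} → Prenex ⊕ (suc k) φ → Prenex ⊕ (suc k) (∃̇ φ)
  Prenex-∃ (prenex h t u) = prenex (h∃ h) (λ p → ∃E p (∃I₀ (t v0))) (λ p → ∃E p (∃I₀ (u v0)))

  Prenex-∀ : ∀ {k φ} → Prenex ⊖ (suc k) φ → Prenex ⊖ (suc k) (∀̇ φ)
  Prenex-∀ (prenex h t u) = prenex (h∀ h) (λ p → ∀I (t (∀E₀ (↑ p)))) (λ p → ∀I (u (∀E₀ (↑ p))))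

  ∧-swap : ∀ {Γ φ ψ} → Γ ⊩ φ ∧̇ ψ → Γ ⊩ ψ ∧̇ φ
  ∧-swap p = ∧I (∧E₂ p) (∧E₁ p)

  Prenex-∃∧ : ∀ {k φ ψ} → Prenex ⊕ (suc k) (φ ∧̇ shift ψ) → Prenex ⊕ (suc k) (∃̇ φ ∧̇ ψ)
  Prenex-∃∧ = Prenex-≈
      (λ p → ∃E p (∧I (∃I₀ (∧E₁ v0)) (∧E₂ v0)))
      (λ p → ∃E (∧E₁ p) (∃I₀ (∧I v0 (wk (↑ (∧E₂ p))))))
    ∘ Prenex-∃

  Prenex-∀∧ : ∀ {k φ ψ} → Prenex ⊖ (suc k) (φ ∧̇ shift ψ) → Prenex ⊖ (suc k) (∀̇ φ ∧̇ ψ)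
  Prenex-∀∧ {ψ = ψ} = Prenex-≈
      -- The bound variable does not occur in `shift ψ`, so any instance returns `ψ`; `0̇` supplies
      -- one.
      (λ p → ∧I (∀I (∧E₁ (∀E₀ (↑ p)))) (cast (shift-[] ψ 0̇) (∧E₂ (∀E p 0̇))))
      (λ p → ∀I (∧I (∀E₀ (↑ (∧E₁ p))) (↑ (∧E₂ p))))
    ∘ Prenex-∀

  mutual
    -- The outer block of one conjunct is pulled out first, then, in `H-∧-hs`, that of the other;
    -- with both exhausted the level drops and the sign flips. Blocks of equal sign thus merge and
    -- no level is added.
    H-∧ : ∀ {b} k {φ ψ} → H b k φ → H b k ψ → Prenex b k (φ ∧̇ ψ)
    H-∧ zero    (h0 p) (h0 q) = Prenex-QF (qf-∧ p q)
    H-∧ (suc k) (hs h) h′     = Prenex-≈ ∧-swap ∧-swap (H-∧-hs k h′ h)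
    H-∧ (suc k) (h∃ h) h′     = Prenex-∃∧ (H-∧ (suc k) h (H-subst _ h′))
    H-∧ (suc k) (h∀ h) h′     = Prenex-∀∧ (H-∧ (suc k) h (H-subst _ h′))

    H-∧-hs : ∀ {b} k {φ ψ} → H b (suc k) φ → H (swap b) k ψ → Prenex b (suc k) (φ ∧̇ ψ)
    H-∧-hs k (hs h) h′ = Prenex-hs (H-∧ k h h′)
    H-∧-hs k (h∃ h) h′ = Prenex-∃∧ (H-∧-hs k h (H-subst _ h′))
    H-∧-hs k (h∀ h) h′ = Prenex-∀∧ (H-∧-hs k h (H-subst _ h′))

  Prenex-∧ : ∀ {b k φ ψ} → Prenex b k φ → Prenex b k ψ → Prenex b k (φ ∧̇ ψ)
  Prenex-∧ {k = k} (prenex h t u) (prenex h′ t′ u′) = Prenex-≈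
    (λ p → ∧I (u (∧E₁ p)) (u′ (∧E₂ p))) (λ p → ∧I (t (∧E₁ p)) (t′ (∧E₂ p))) (H-∧ k h h′)

  Prenex-complement : ∀ {b k φ} → k ≤ K → Prenex b k φ → ∃ λ χ → H (swap b) k χ × Complement φ χ
  Prenex-complement l (prenex h t u) =
    let χ , h′ , c = complement l h
    in  χ , h′ , compl (∨E (total c) (∨I₁ (u v0)) (∨I₂ v0)) (λ p q → disjoint c (t p) q)

  Complement⇒dec : ∀ {φ χ Γ} → Complement φ χ → Γ ⊩ φ ∨̇ ¬̇ φ
  Complement⇒dec c = ∨E (total c) (∨I₁ v0) (∨I₂ (⇒I (disjoint c v0 v1)))

  Prenex-dec : ∀ {b k φ Γ} → k ≤ K → Prenex b k φ → Γ ⊩ φ ∨̇ ¬̇ φ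
  Prenex-dec l p = Complement⇒dec (proj₂ (proj₂ (Prenex-complement l p)))

  Prenex-¬ : ∀ {b k φ} → k ≤ K → Prenex b k φ → Prenex (swap b) k (¬̇ φ)
  Prenex-¬ l p =
    let χ , h , c = Prenex-complement l p
    in  prenex h (λ q → ∨E (total c) (⊥E (⇒E (wk q) v0)) v0) (λ q → ⇒I (disjoint c v0 (wk q)))

  swap-involutive : ∀ b → swap (swap b) ≡ b
  swap-involutive ⊕ = refl
  swap-involutive ⊖ = refl

  Prenex-¬′ : ∀ {b k φ} → k ≤ K → Prenex (swap b) k φ → Prenex b k (¬̇ φ)
  Prenex-¬′ {b} {k} {φ} l p =
    transport (λ c → Prenex c k (¬̇ φ)) (swap-involutive b) (Prenex-¬ l p)

  -- Since `ψ` is decidable, the implication amounts to `¬̇ (φ ∧̇ ¬̇ ψ)`, which leaves only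
  -- conjunction and negation to treat.
  Prenex-⇒ : ∀ {b k φ ψ} → k ≤ K → Prenex (swap b) k φ → Prenex b k ψ → Prenex b k (φ ⇒ ψ)
  Prenex-⇒ l p q = Prenex-≈
    (λ r → ⇒I (∨E (Prenex-dec l q) v0 (⊥E (⇒E (wk (wk r)) (∧I v1 v0)))))
    (λ r → ⇒I (⇒E (∧E₂ v0) (⇒E (wk r) (∧E₁ v0))))
    (Prenex-¬′ l (Prenex-∧ p (Prenex-¬ l q)))

  Prenex-∨ : ∀ {b k φ ψ} → k ≤ K → Prenex b k φ → Prenex b k ψ → Prenex b k (φ ∨̇ ψ)
  Prenex-∨ l p q = Prenex-≈
    (λ r → ∨E (Prenex-dec l p) (∨I₁ v0) (∨I₂ (⇒E (wk r) v0)))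
    (λ r → ⇒I (∨E (wk r) (⊥E (⇒E v1 v0)) v0))
    (Prenex-⇒ l (Prenex-¬ l p) q)

  -- Counting each path as if a quantifier of sign `b` preceded it gives an invariant for landing on
  -- side `b` of the hierarchy; an antecedent is sent to the opposite side.
  Deg≤[]⇒Prenex : ∀ b k φ → k ≤ K → Deg≤[ b ] k φ → Prenex b k φ
  Deg≤[]⇒Prenex b k (s ≐ t) l d = Prenex-QF qf-eq
  Deg≤[]⇒Prenex b k ⊥̇       l d = Prenex-QF qf-⊥
  Deg≤[]⇒Prenex b k (φ ∧̇ ψ) l d =
    let d₁ , d₂ = All-Alt-∧⁻ φ ψ d
    in  Prenex-∧ (Deg≤[]⇒Prenex b k φ l d₁) (Deg≤[]⇒Prenex b k ψ l d₂)
  Deg≤[]⇒Prenex b k (φ ∨̇ ψ) l d =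
    let d₁ , d₂ = All-Alt-∨⁻ φ ψ d
    in  Prenex-∨ l (Deg≤[]⇒Prenex b k φ l d₁) (Deg≤[]⇒Prenex b k ψ l d₂)
  Deg≤[]⇒Prenex b k (φ ⇒ ψ) l d =
    let d₁ , d₂ = Deg≤[]-⇒⁻ {b} φ ψ d
    in  Prenex-⇒ l (Deg≤[]⇒Prenex (swap b) k φ l d₁) (Deg≤[]⇒Prenex b k ψ l d₂)
  Deg≤[]⇒Prenex b zero (∀̇ φ) l d with () ← Deg≤[]⇒1≤ {b} (∀̇ φ) d
  Deg≤[]⇒Prenex b zero (∃̇ φ) l d with () ← Deg≤[]⇒1≤ {b} (∃̇ φ) d
  Deg≤[]⇒Prenex ⊖ (suc k) (∀̇ φ) l d =
    Prenex-∀ (Deg≤[]⇒Prenex ⊖ (suc k) φ l (Deg≤[]-same {⊖} φ d))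
  Deg≤[]⇒Prenex ⊕ (suc k) (∃̇ φ) l d =
    Prenex-∃ (Deg≤[]⇒Prenex ⊕ (suc k) φ l (Deg≤[]-same {⊕} φ d))
  -- The opposite quantifier opens a block one level down. `Prenex-∀` needs that level to be a
  -- successor, which `Deg≤[]⇒1≤` ensures.
  Deg≤[]⇒Prenex ⊕ (suc k) (∀̇ φ) l d with Deg≤[]-alternate {⊖} φ d
  ... | d′ with Deg≤[]⇒1≤ {⊖} φ d′
  ... | s≤s z≤n = Prenex-hs (Prenex-∀ (Deg≤[]⇒Prenex ⊖ k φ (≤-trans (n≤1+n k) l) d′))
  Deg≤[]⇒Prenex ⊖ (suc k) (∃̇ φ) l d with Deg≤[]-alternate {⊕} φ d
  ... | d′ with Deg≤[]⇒1≤ {⊕} φ d′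
  ... | s≤s z≤n = Prenex-hs (Prenex-∃ (Deg≤[]⇒Prenex ⊕ k φ (≤-trans (n≤1+n k) l) d′))

  -- Decidability of formulas of degree at most K

  Deg≤-∀-dual : ∀ {φ Γ} → Deg≤ K (∀̇ φ) → Γ ⊩ ∃̇ (¬̇ φ) ∨̇ ∀̇ φ
  Deg≤-∀-dual {φ} d = dual ≤-refl (map⁻ d)
    where
    -- `K` is fixed by the module; the variable `k` can be refined to a successor.
    dual : ∀ {k Γ} → k ≤ K → Deg≤[ ⊖ ] k φ → Γ ⊩ ∃̇ (¬̇ φ) ∨̇ ∀̇ φ
    dual {k} l d with Deg≤[]⇒1≤ {⊖} φ d
    ... | s≤s z≤n =
      let χ , h , c = Prenex-complement l (Deg≤[]⇒Prenex ⊖ k φ l d)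
      in  ∨E (total (Complement-∃∀ (LEM-H l (h∃ h)) (Complement-sym c)))
             (∨I₁ (∃E v0 (∃I₀ (⇒I (disjoint c v0 v1))))) (∨I₂ v0)

  Deg≤-∃-dec : ∀ {φ Γ} → Deg≤ K (∃̇ φ) → Γ ⊩ ∃̇ φ ∨̇ ¬̇ (∃̇ φ)
  Deg≤-∃-dec {φ} d = dec ≤-refl (map⁻ d)
    where
    dec : ∀ {k Γ} → k ≤ K → Deg≤[ ⊕ ] k φ → Γ ⊩ ∃̇ φ ∨̇ ¬̇ (∃̇ φ)
    dec {k} l d with Deg≤[]⇒1≤ {⊕} φ d
    ... | s≤s z≤n = Prenex-dec l (Prenex-∃ (Deg≤[]⇒Prenex ⊕ k φ l d))

  -- Such a formula may mix parts of both signs and need not fit one side of the hierarchy at level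
  -- `K`. Connectives are therefore decided from their parts, and only quantified subformulas go
  -- through prenex form.
  Deg≤-dec : ∀ {Γ} φ → Deg≤ K φ → Γ ⊩ φ ∨̇ ¬̇ φ
  Deg≤-dec (s ≐ t) d = LEM-H z≤n (h0 qf-eq)
  Deg≤-dec ⊥̇       d = ∨I₂ (⇒I v0)
  Deg≤-dec (φ ∧̇ ψ) d =
    let d₁ , d₂ = All-Alt-∧⁻ φ ψ d
    in  ∨E (Deg≤-dec φ d₁)
          (∨E (Deg≤-dec ψ d₂) (∨I₁ (∧I v1 v0)) (∨I₂ (⇒I (⇒E v1 (∧E₂ v0)))))
          (∨I₂ (⇒I (⇒E v1 (∧E₁ v0))))
  Deg≤-dec (φ ∨̇ ψ) d =
    let d₁ , d₂ = All-Alt-∨⁻ φ ψ d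
    in  ∨E (Deg≤-dec φ d₁) (∨I₁ (∨I₁ v0))
          (∨E (Deg≤-dec ψ d₂) (∨I₁ (∨I₂ v0))
            (∨I₂ (⇒I (∨E v0 (⇒E (wk v2) v0) (⇒E v2 v0)))))
  Deg≤-dec (φ ⇒ ψ) d =
    let d₁ , d₂ = Deg≤-⇒⁻ φ ψ d
    in  ∨E (Deg≤-dec φ d₁)
          (∨E (Deg≤-dec ψ d₂) (∨I₁ (⇒I v1)) (∨I₂ (⇒I (⇒E v1 (⇒E v0 v2)))))
          (∨I₁ (⇒I (⊥E (⇒E v1 v0))))
  Deg≤-dec (∀̇ φ)   d = ∨E (Deg≤-∀-dual d) (∨I₂ (⇒I (∃E v1 (⇒E v0 (∀E₀ v1))))) (∨I₁ v0)
  Deg≤-dec (∃̇ φ)   d = Deg≤-∃-dec d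

  -- The translation on formulas of degree at most K

  mutual
    Deg≤-tr : ∀ {Γ} C φ → Deg≤ K φ → Γ ⊩ φ → Γ ⊩ tr C φ
    Deg≤-tr C (s ≐ t) d p = nn-intro p
    Deg≤-tr C ⊥̇       d p = ⊥E p
    Deg≤-tr C (φ ∧̇ ψ) d p =
      let d₁ , d₂ = All-Alt-∧⁻ φ ψ d
      in  ∧I (Deg≤-tr C φ d₁ (∧E₁ p)) (Deg≤-tr C ψ d₂ (∧E₂ p))
    Deg≤-tr C (φ ∨̇ ψ) d p =
      let d₁ , d₂ = All-Alt-∨⁻ φ ψ d
      in  nn-intro (∨E p (∨I₁ (Deg≤-tr C φ d₁ v0)) (∨I₂ (Deg≤-tr C ψ d₂ v0)))
    Deg≤-tr C (φ ⇒ ψ) d p =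
      let d₁ , d₂ = Deg≤-⇒⁻ φ ψ d
      in  ⇒I (∨E (Deg≤-dec φ d₁)
            (Deg≤-tr C ψ d₂ (⇒E (wk (wk p)) v0))
            (tr-absurd C ψ (Deg≤-tr-¬ C φ d₁ v0 v1)))
    Deg≤-tr C (∀̇ φ)   d p = ∀I (Deg≤-tr (shift C) φ (Deg≤-∀⁻ φ d) (∀E₀ (↑ p)))
    Deg≤-tr C (∃̇ φ)   d p = nn-intro (∃E p (∃I₀ (Deg≤-tr (shift C) φ (Deg≤-∃⁻ φ d) v0)))

    -- With decidability this is a converse of `Deg≤-tr` up to `C`: a translated formula yields the
    -- formula or `C`. The two are mutual because of antecedents.
    Deg≤-tr-¬ : ∀ {Γ} C φ → Deg≤ K φ → Γ ⊩ ¬̇ φ → Γ ⊩ tr C φ → Γ ⊩ C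
    Deg≤-tr-¬ C (s ≐ t) d p q = ⇒E q (⇒I (⊥E (⇒E (wk p) v0)))
    Deg≤-tr-¬ C ⊥̇       d p q = q
    Deg≤-tr-¬ C (φ ∧̇ ψ) d p q =
      let d₁ , d₂ = All-Alt-∧⁻ φ ψ d
      in  ∨E (Deg≤-dec φ d₁)
            (Deg≤-tr-¬ C ψ d₂ (⇒I (⇒E (wk (wk p)) (∧I v1 v0))) (wk (∧E₂ q)))
            (Deg≤-tr-¬ C φ d₁ v0 (wk (∧E₁ q)))
    Deg≤-tr-¬ C (φ ∨̇ ψ) d p q =
      let d₁ , d₂ = All-Alt-∨⁻ φ ψ d
      in  ⇒E q (⇒I (∨E v0
            (Deg≤-tr-¬ C φ d₁ (⇒I (⇒E (wk (wk (wk p))) (∨I₁ v0))) v0)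
            (Deg≤-tr-¬ C ψ d₂ (⇒I (⇒E (wk (wk (wk p))) (∨I₂ v0))) v0)))
    Deg≤-tr-¬ C (φ ⇒ ψ) d p q =
      let d₁ , d₂ = Deg≤-⇒⁻ φ ψ d
      in  ∨E (Deg≤-dec φ d₁)
            (Deg≤-tr-¬ C ψ d₂ (⇒I (⇒E (wk (wk p)) (⇒I v1))) (⇒E (wk q) (Deg≤-tr C φ d₁ v0)))
            (⊥E (⇒E (wk p) (⇒I (⊥E (⇒E v1 v0)))))
    -- A refuted universal formula has a counterexample, and the translation instantiated there
    -- gives `C`.
    Deg≤-tr-¬ C (∀̇ φ)   d p q = ∨E (Deg≤-∀-dual d)
      (∃E v0 (Deg≤-tr-¬ (shift C) φ (Deg≤-∀⁻ φ d) v0 (∀E₀ (wk (wk (↑ q))))))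
      (⊥E (⇒E (wk p) v0))
    Deg≤-tr-¬ C (∃̇ φ)   d p q = ⇒E q (⇒I (∃E v0
      (Deg≤-tr-¬ (shift C) φ (Deg≤-∃⁻ φ d) (⇒I (⇒E (wk (wk (wk (↑ p)))) (∃I₀ v0))) v0)))

  -- The translation on the classes R, J and Q

  mutual
    -- Beyond the base class case distinctions are replaced by the hypotheses `¬̇ φ ⇒ C` here and
    -- `φ ⇒ C` in `𝓙-tr`, which turn into each other at implications.
    𝓡-tr : ∀ {Γ φ} C → 𝓡 (suc K) φ → Γ ⊩ ¬̇ φ ⇒ C → Γ ⊩ tr C φ
    𝓡-tr {φ = φ} C (rF d) p =
      ∨E (Deg≤-dec φ (F⁺⇒Deg≤ φ d))
        (Deg≤-tr C φ (F⁺⇒Deg≤ φ d) v0)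
        (tr-absurd C φ (⇒E (wk p) v0))
    𝓡-tr C (r∧ r s) p = ∧I
      (𝓡-tr C r (⇒I (⇒E (wk p) (⇒I (⇒E v1 (∧E₁ v0))))))
      (𝓡-tr C s (⇒I (⇒E (wk p) (⇒I (⇒E v1 (∧E₂ v0))))))
    -- The disjuncts are tried in turn: refuting the first still leaves the second, and refuting
    -- both refutes the disjunction.
    𝓡-tr C (r∨ r s) p = ⇒I (⇒E v0 (∨I₁ (𝓡-tr C r
      (⇒I (⇒E v1 (∨I₂ (𝓡-tr C s
        (⇒I (⇒E (wk (wk (wk p))) (⇒I (∨E v0 (⇒E (wk v2) v0) (⇒E v2 v0))))))))))))
    𝓡-tr C (r∀ r)   p = ∀I (𝓡-tr (shift C) r (⇒I (⇒E (wk (↑ p)) (⇒I (⇒E v1 (∀E₀ v0))))))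
    -- Once the consequent is refuted, the antecedent refutes the implication and so gives `C`, as
    -- `𝓙-tr` requires.
    𝓡-tr C (r⇒ j r) p = ⇒I (𝓡-tr C r (⇒I (𝓙-tr C j
      (⇒I (⇒E (wk (wk (wk p))) (⇒I (⇒E v2 (⇒E v0 v1))))) v1)))

    𝓙-tr : ∀ {Γ φ} C → 𝓙 (suc K) φ → Γ ⊩ φ ⇒ C → Γ ⊩ tr C φ → Γ ⊩ C
    𝓙-tr {φ = φ} C (jF d) p q =
      ∨E (Deg≤-dec φ (F⁺⇒Deg≤ φ d))
        (⇒E (wk p) v0)
        (Deg≤-tr-¬ C φ (F⁺⇒Deg≤ φ d) v0 (wk q))
    𝓙-tr C (j∧ i j) p q = 𝓙-tr C i
      (⇒I (𝓙-tr C j (⇒I (⇒E (wk (wk p)) (∧I v1 v0))) (wk (∧E₂ q)))) (∧E₁ q)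
    𝓙-tr C (j∨ i j) p q = ⇒E q (⇒I (∨E v0
      (𝓙-tr C i (⇒I (⇒E (wk (wk (wk p))) (∨I₁ v0))) v0)
      (𝓙-tr C j (⇒I (⇒E (wk (wk (wk p))) (∨I₂ v0))) v0)))
    𝓙-tr C (j∃ j)   p q = ⇒E q (⇒I (∃E v0
      (𝓙-tr (shift C) j (⇒I (⇒E (wk (wk (wk (↑ p)))) (∃I₀ v0))) v0)))
    -- The implication holds if its consequent does, and vacuously if its antecedent is refuted;
    -- either way `p` gives `C`.
    𝓙-tr C (j⇒ r j) p q = 𝓙-tr C j (⇒I (⇒E (wk p) (⇒I v1)))
      (⇒E q (𝓡-tr C r (⇒I (⇒E (wk p) (⇒I (⊥E (⇒E v1 v0)))))))

  𝓠-tr : ∀ {Γ φ} C → 𝓠 (suc K) φ → Γ ⊩ φ → Γ ⊩ tr C φ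
  𝓠-tr C (qP pr-eq) p = nn-intro p
  𝓠-tr C (qP pr-⊥)  p = ⊥E p
  𝓠-tr C (q∧ q r)   p = ∧I (𝓠-tr C q (∧E₁ p)) (𝓠-tr C r (∧E₂ p))
  𝓠-tr C (q∨ q r)   p = nn-intro (∨E p (∨I₁ (𝓠-tr C q v0)) (∨I₂ (𝓠-tr C r v0)))
  𝓠-tr C (q∀ q)     p = ∀I (𝓠-tr (shift C) q (∀E₀ (↑ p)))
  𝓠-tr C (q∃ q)     p = nn-intro (∃E p (∃I₀ (𝓠-tr (shift C) q v0)))
  -- By stability it is enough to derive `C` from `tr C ψ ⇒ C`; under this assumption the antecedent
  -- gives `C` by way of `ψ`.
  𝓠-tr C (q⇒ {ψ = ψ} j q) p = ⇒I (tr-stable C ψ (⇒I (𝓙-tr C j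
    (⇒I (⇒E v1 (𝓠-tr C q (⇒E (wk (wk (wk p))) v0)))) v1)))

  -- With `ψ` in the context, outer `∧̇` and `∀̇` are removed by elimination inside PA; the `∀̇`
  -- case shifts `ψ`, hence `𝓠-subst`.
  𝓥-conservative : ∀ {φ ψ} → 𝓥 (suc K) φ → 𝓠 (suc K) ψ → Prf PA (ψ ∷ []) φ → ψ ∷ [] ⊩ φ
  𝓥-conservative {φ} (vJ j) q p =
    -- For `C` equal to `φ` the premise `φ ⇒ C` is the identity.
    𝓙-tr φ j (⇒I v0) (⇒E (⇒I (weaken (⊆-∷ λ ()) (tr-sound inj₁ φ p))) (𝓠-tr φ q v0))
  𝓥-conservative (v∧ v w) q p =
    ∧I (𝓥-conservative v q (∧E₁ p)) (𝓥-conservative w q (∧E₂ p))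
  𝓥-conservative (v∀ v)   q p = ∀I (𝓥-conservative v (𝓠-subst _ q) (∀E₀ (↑ p)))

theorem3p17 : (k : ℕ) (φ ψ : Formula) → 𝓥 (suc k) φ → 𝓠 (suc k) ψ →
    PA ⊢ (ψ ⇒ φ) → HA+LEMΣ k ⊢ (ψ ⇒ φ)
theorem3p17 k φ ψ v q p = ⇒I (Conservation.𝓥-conservative k v q (⇒E (wk p) v0))
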